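{- Consider the faulty-starter delivery problem described in the context, with finisher starting position $(x,y)\neq(0,0)$, $y\ge 0$, and assume $(x,y)\in\overline{D}(1,1)$, i.e. $\sqrt{(x-1)^2+y^2}\le1$. Then the competitive ratio of $\mathcal{A}_d$ is $$\mathrm{CR}_{\mathcal{A}_d}=\begin{cases}\dfrac{x^2+y^2+x}{x\left(1+\sqrt{x^2+y^2}\right)} & \text{if }(x,y)\in\overline{D}(1/2,1/2),\\[2mm] 1+\dfrac{y^2}{x(\sqrt{x}+1)^2} & \text{otherwise.}\end{cases}$$
   Context: Setting. In the plane let $S=(0,0)$ and $T=(1,0)$. A "starter" drone carrying a package starts at $S$ at time $0$ and moves at unit speed along $\overline{ST}$ towards $T$. At an unknown time $t\in[0,1]$ it fails and stays forever at $(t,0)$ with the package (at time $s$ the package is at $(\min\{s,t\},0)$). A "finisher" drone starts at time $0$ at $P=(x,y)$ with $y\ge0$, moves at unit speed and can stop and turn instantaneously. The package can be handed over only when the drones are co-located; it is delivered at the first time the finisher, carrying the package, is at $T$. An online algorithm $\mathcal{A}$ specifies the finisher's trajectory using only $(x,y)$; $A(t)$ is its delivery time for fail time $t$. $\mathrm{Opt}(t)=\max\{1,\sqrt{(x-t)^2+y^2}+1-t\}$ is the optimal offline delivery time. $\mathrm{CR}_{\mathcal{A}}(t)=A(t)/\mathrm{Opt}(t)$ and $\mathrm{CR}_{\mathcal{A}}=\sup_{0\le t\le1}\mathrm{CR}_{\mathcal{A}}(t)$. $\overline{D}(c,r)$ denotes the closed disk of radius $r$ centered at $(c,0)$. Algorithm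 $\mathcal{A}_d$ (for $x>0$): let $d=(x^2+y^2)/(2x)$ (the point $(d,0)$ satisfies $\sqrt{(x-d)^2+y^2}=d$); the finisher goes straight to $(d,0)$, then moves along the segment towards $S$ until it finds the package, then goes to $T$. -}

module Defs where

open import Level as Level using (suc)
open import Algebra.Apartness.Bundles using (HeytingField)
open import Algebra.Bundles using (CommutativeRing)
import Algebra.Apartness.Properties.HeytingCommutativeRing as HeytingProperties
import Algebra.Properties.Ring as RingProperties
import Algebra.Solver.Ring.NaturalCoefficients.Default as NatSolver
open import Data.Nat.Base as ℕ using (ℕ)
open import Data.Nat.GeneralisedArithmetic using (fold)
open import Data.Product.Base using (Σ; ∃-syntax; _×_; _,_; proj₁; proj₂)
open import Data.Sum.Base using (_⊎_; inj₁; inj₂)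
open import Data.Empty using (⊥-elim)
open import Function.Bundles using (_⇔_; Equivalence)
open import Relation.Binary.Core using (Rel)
open import Relation.Binary.Structures using (IsStrictPartialOrder)
open import Relation.Binary.Lattice.Definitions using (Supremum; Infimum)
open import Relation.Nullary.Negation.Core using (¬_)

-- The real numbers, axiomatised as a Cauchy-complete Archimedean ordered field.
-- The order is the constructive one (x ≤ y is ¬ (y < x), no trichotomy), so
-- that both the classical field ℝ and Bishop's reals are instances.  Binary
-- maxima and minima and square roots, which the field has anyway, are
-- included as operations; each is determined up to ≈ by its axioms.
record RealField c ℓ₁ ℓ₂ : Set (suc (c Level.⊔ ℓ₁ Level.⊔ ℓ₂)) where
  infix  4 _<_ _≤_
  infixr 7 _⊓_
  infixr 6 _⊔_
  field
    heytingField : HeytingField c ℓ₁ ℓ₂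

  open HeytingField heytingField public renaming (Carrier to ℝ)

  field
    _<_                    : Rel ℝ ℓ₂
    <-isStrictPartialOrder : IsStrictPartialOrder _≈_ _<_
    #⇔<⊎>                  : ∀ {x y} → x # y ⇔ (x < y ⊎ y < x)
    +-monoˡ-<              : ∀ z {x y} → x < y → x + z < y + z
    *-pos                  : ∀ {x y} → 0# < x → 0# < y → 0# < x * y

  _≤_ : Rel ℝ ℓ₂
  x ≤ y = ¬ (y < x)

  field
    _⊔_ _⊓_     : ℝ → ℝ → ℝ
    ⊔-supremum  : Supremum _≤_ _⊔_
    ⊓-infimum   : Infimum _≤_ _⊓_
    √           : ℝ → ℝ
    √-nonneg    : ∀ {x} → 0# ≤ x → 0# ≤ √ x
    √-square    : ∀ {x} → 0# ≤ x → √ x * √ x ≈ x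

  ∣_∣ : ℝ → ℝ
  ∣ x ∣ = x ⊔ (- x)

  fromℕ : ℕ → ℝ
  fromℕ = fold 0# (_+ 1#)

  Cauchy : (ℕ → ℝ) → Set (c Level.⊔ ℓ₂)
  Cauchy u = ∀ ε → 0# < ε →
    ∃[ N ] (∀ m n → N ℕ.≤ m → N ℕ.≤ n → ∣ u m - u n ∣ < ε)

  _⟶_ : (ℕ → ℝ) → ℝ → Set (c Level.⊔ ℓ₂)
  u ⟶ l = ∀ ε → 0# < ε → ∃[ N ] (∀ n → N ℕ.≤ n → ∣ u n - l ∣ < ε)

  field
    archimedean : ∀ x → ∃[ n ] (x < fromℕ n)
    complete    : ∀ u → Cauchy u → ∃[ l ] (u ⟶ l)


module OrderLemmas {c ℓ₁ ℓ₂} (R : RealField c ℓ₁ ℓ₂) where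
  open RealField R

  open IsStrictPartialOrder <-isStrictPartialOrder public
    using (<-respˡ-≈; <-respʳ-≈)
    renaming (irrefl to <-irrefl; trans to <-trans)

  private
    commutativeRing : CommutativeRing c ℓ₁
    commutativeRing = record { isCommutativeRing = isCommutativeRing }

    open RingProperties (CommutativeRing.ring commutativeRing)
      using (-‿distribˡ-*; -‿distribʳ-*; -‿involutive)
    open NatSolver (CommutativeRing.commutativeSemiring commutativeRing)
      using (solve; _:=_; _:+_; _:*_; con)
    open HeytingProperties heytingCommutativeRing using (1#0; x-0≈x; invertibleʳ⇒#)

  <-cotrans : ∀ {x y} → x < y → ∀ z → x < z ⊎ z < y
  <-cotrans x<y z with #-cotrans (Equivalence.from #⇔<⊎> (inj₁ x<y)) z
  ... | inj₁ x#z with Equivalence.to #⇔<⊎> x#z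
  ...   | inj₁ x<z = inj₁ x<z
  ...   | inj₂ z<x = inj₂ (<-trans z<x x<y)
  <-cotrans x<y z | inj₂ z#y with Equivalence.to #⇔<⊎> z#y
  ...   | inj₁ z<y = inj₂ z<y
  ...   | inj₂ y<z = inj₁ (<-trans x<y y<z)

  <-≤-trans : ∀ {x y z} → x < y → y ≤ z → x < z
  <-≤-trans {z = z} x<y y≤z with <-cotrans x<y z
  ... | inj₁ x<z = x<z
  ... | inj₂ z<y = ⊥-elim (y≤z z<y)

  <⇒≤ : ∀ {x y} → x < y → x ≤ y
  <⇒≤ x<y y<x = <-irrefl refl (<-trans x<y y<x)

  +-cancelʳ-< : ∀ z {x y} → x + z < y + z → x < y
  +-cancelʳ-< z h = <-respˡ-≈ (cancel _) (<-respʳ-≈ (cancel _) (+-monoˡ-< (- z) h))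
    where
    cancel : ∀ w → (w + z) + - z ≈ w
    cancel w = trans (+-assoc w z (- z)) (trans (+-congˡ (-‿inverseʳ z)) (+-identityʳ w))

  0<-x : ∀ {x} → x < 0# → 0# < - x
  0<-x {x} x<0 =
    <-respˡ-≈ (-‿inverseʳ x) (<-respʳ-≈ (+-identityˡ (- x)) (+-monoˡ-< (- x) x<0))

  private
    -x*-x≈x*x : ∀ x → (- x) * (- x) ≈ x * x
    -x*-x≈x*x x = trans (sym (-‿distribˡ-* x (- x)))
      (trans (-‿cong (sym (-‿distribʳ-* x x))) (-‿involutive (x * x)))

  #0⇒0<x*x : ∀ {x} → x # 0# → 0# < x * x
  #0⇒0<x*x {x} x#0 with Equivalence.to #⇔<⊎> x#0
  ... | inj₁ x<0 = <-respʳ-≈ (-x*-x≈x*x x) (*-pos (0<-x x<0) (0<-x x<0))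
  ... | inj₂ 0<x = *-pos 0<x 0<x

  0≤x*x : ∀ x → 0# ≤ x * x
  0≤x*x x xx<0 = <-irrefl (trans (*-congˡ x≈0) (zeroʳ x)) xx<0
    where
    x≈0 : x ≈ 0#
    x≈0 = proj₁ (tight x 0#) (λ x#0 → <⇒≤ (#0⇒0<x*x x#0) xx<0)

  pos+nonneg : ∀ {x y} → 0# < x → 0# ≤ y → 0# < x + y
  pos+nonneg {x} {y} 0<x 0≤y = <-≤-trans 0<x x≤x+y
    where
    x≤x+y : x ≤ x + y
    x≤x+y h = 0≤y (+-cancelʳ-< x
      (<-respˡ-≈ (+-comm x y) (<-respʳ-≈ (sym (+-identityˡ x)) h)))

  nonneg+nonneg : ∀ {x y} → 0# ≤ x → 0# ≤ y → 0# ≤ x + y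
  nonneg+nonneg {x} {y} 0≤x 0≤y x+y<0 with <-cotrans x+y<0 y
  ... | inj₁ x+y<y = 0≤x (+-cancelʳ-< y (<-respʳ-≈ (sym (+-identityˡ y)) x+y<y))
  ... | inj₂ y<0   = 0≤y y<0

  0<1 : 0# < 1#
  0<1 = <-respʳ-≈ (*-identityˡ 1#) (#0⇒0<x*x 1#0)

  #0⇒0< : ∀ {x} → 0# ≤ x → x # 0# → 0# < x
  #0⇒0< 0≤x x#0 with Equivalence.to #⇔<⊎> x#0
  ... | inj₁ x<0 = ⊥-elim (0≤x x<0)
  ... | inj₂ 0<x = 0<x

  0<⇒#0 : ∀ {x} → 0# < x → x # 0#
  0<⇒#0 0<x = Equivalence.from #⇔<⊎> (inj₂ 0<x)

  infixl 7 _/_[_]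

  _/_[_] : (a b : ℝ) → 0# < b → ℝ
  a / b [ 0<b ] = a * proj₁ (#⇒invertible (0<⇒#0 0<b))

  /-cancel : ∀ a {b} (0<b : 0# < b) → b * (a / b [ 0<b ]) ≈ a
  /-cancel a {b} 0<b with #⇒invertible (0<⇒#0 0<b)
  ... | b⁻¹ , _ , bb⁻¹≈1 = trans
    (solve 3 (λ b a i → b :* (a :* i) := a :* (b :* i)) refl b a b⁻¹)
    (trans (*-congˡ (trans (*-congʳ (sym (x-0≈x b))) bb⁻¹≈1)) (*-identityʳ a))

  √-pos : ∀ {x} → 0# < x → 0# < √ x
  √-pos {x} 0<x = #0⇒0< (√-nonneg 0≤x) (invertibleʳ⇒# (√ x / x [ 0<x ] , inverse))
    where
    0≤x : 0# ≤ x
    0≤x = <⇒≤ 0<x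
    i = proj₁ (#⇒invertible (0<⇒#0 0<x))
    inverse : (√ x - 0#) * (√ x * i) ≈ 1#
    inverse = trans (*-congʳ (x-0≈x (√ x))) (trans (sym (*-assoc (√ x) (√ x) i))
      (trans (*-congʳ (trans (√-square 0≤x) (sym (x-0≈x x))))
        (proj₂ (proj₂ (#⇒invertible (0<⇒#0 0<x))))))

  /-pos : ∀ {a b} → 0# < a → (0<b : 0# < b) → 0# < a / b [ 0<b ]
  /-pos {a} {b} 0<a 0<b = #0⇒0< 0≤q q#0
    where
    q = a / b [ 0<b ]
    0<bq : 0# < b * q
    0<bq = <-respʳ-≈ (sym (/-cancel a 0<b)) 0<a
    0≤q : 0# ≤ q
    0≤q q<0 = <⇒≤ (*-pos 0<b (0<-x q<0))
      (<-respˡ-≈ (-‿distribʳ-* b q) (-x<0 0<bq))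
      where
      -x<0 : ∀ {x} → 0# < x → - x < 0#
      -x<0 {x} 0<x =
        <-respˡ-≈ (+-identityˡ (- x)) (<-respʳ-≈ (-‿inverseʳ x) (+-monoˡ-< (- x) 0<x))
    q#0 : q # 0#
    q#0 = invertibleʳ⇒# (b / a [ 0<a ] , (trans (*-congʳ (x-0≈x q))
      (trans (solve 3 (λ b q i → q :* (b :* i) := (b :* q) :* i) refl b q _)
        (trans (*-congʳ (trans (/-cancel a 0<b) (sym (x-0≈x a))))
          (proj₂ (proj₂ (#⇒invertible (0<⇒#0 0<a))))))))

  0<2 : 0# < 1# + 1#
  0<2 = pos+nonneg 0<1 (<⇒≤ 0<1)

  ½ : ℝ
  ½ = 1# / (1# + 1#) [ 0<2 ]

  √≤1⇒≤1 : ∀ {a} → 0# ≤ a → √ a ≤ 1# → a ≤ 1#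
  √≤1⇒≤1 {a} 0≤a s≤1 1<a = <-irrefl refl
    (<-respʳ-≈ (trans (sym (√-square 0≤a)) (trans (*-cong s≈1 s≈1) (*-identityˡ 1#))) 1<a)
    where
    s = √ a
    e = 1# - s
    e+s≈1 : e + s ≈ 1#
    e+s≈1 = trans (+-assoc 1# (- s) s) (trans (+-congˡ (-‿inverseˡ s)) (+-identityʳ 1#))
    s<1⇒a<1 : s < 1# → a < 1#
    s<1⇒a<1 s<1 = <-respˡ-≈ (trans (+-identityˡ (s * s)) (√-square 0≤a))
      (<-respʳ-≈ sum≈1 (+-monoˡ-< (s * s) (*-pos 0<e (pos+nonneg 0<1 (√-nonneg 0≤a)))))
      where
      0<e : 0# < e
      0<e = <-respˡ-≈ (-‿inverseʳ s) (+-monoˡ-< (- s) s<1)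
      sum≈1 : e * (1# + s) + s * s ≈ 1#
      sum≈1 = trans
        (solve 2 (λ e s → e :* (con 1 :+ s) :+ s :* s := e :+ s :* (e :+ s)) refl e s)
        (trans (+-congˡ (trans (*-congˡ e+s≈1) (*-identityʳ s))) e+s≈1)
    s≈1 : s ≈ 1#
    s≈1 = proj₁ (tight s 1#) λ s#1 → case (Equivalence.to #⇔<⊎> s#1)
      where
      case : ¬ (s < 1# ⊎ 1# < s)
      case (inj₁ s<1) = <⇒≤ (s<1⇒a<1 s<1) 1<a
      case (inj₂ 1<s) = s≤1 1<s

  0<x+x⇒0<x : ∀ {x} → 0# < x + x → 0# < x
  0<x+x⇒0<x {x} 0<x+x with <-cotrans 0<x+x x
  ... | inj₁ 0<x   = 0<x
  ... | inj₂ x<x+x = +-cancelʳ-< x (<-respˡ-≈ (sym (+-identityˡ x)) x<x+x)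


module Plane {c ℓ₁ ℓ₂} (R : RealField c ℓ₁ ℓ₂) where
  open RealField R
  open OrderLemmas R

  infix 4 _≈ₚ_ _#ₚ_ _∈D̄[_,_]

  Point : Set c
  Point = ℝ × ℝ

  _≈ₚ_ : Rel Point ℓ₁
  (a , b) ≈ₚ (a′ , b′) = a ≈ a′ × b ≈ b′

  -- The positive form of ≠ for points.
  _#ₚ_ : Rel Point ℓ₂
  (a , b) #ₚ (a′ , b′) = a # a′ ⊎ b # b′

  _+ₚ_ _-ₚ_ : Point → Point → Point
  (a , b) +ₚ (a′ , b′) = a + a′ , b + b′
  (a , b) -ₚ (a′ , b′) = a - a′ , b - b′

  _·ₚ_ : ℝ → Point → Point
  k ·ₚ (a , b) = k * a , k * b

  dist : Point → Point → ℝ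
  dist (a , b) (a′ , b′) = √ ((a - a′) * (a - a′) + (b - b′) * (b - b′))

  _∈D̄[_,_] : Point → ℝ → ℝ → Set ℓ₂
  Q ∈D̄[ a , r ] = dist Q (a , 0#) ≤ r

  IsSupremum : ∀ {p} → (ℝ → Set p) → ℝ → Set (c Level.⊔ ℓ₂ Level.⊔ p)
  IsSupremum X v = (∀ r → X r → r ≤ v) × (∀ u → (∀ r → X r → r ≤ u) → v ≤ u)

  IsLeast : ∀ {p} → (ℝ → Set p) → ℝ → Set (c Level.⊔ ℓ₂ Level.⊔ p)
  IsLeast X s = X s × (∀ s′ → X s′ → s ≤ s′)

  -- Displacement after time τ of a unit-speed straight motion that leaves A at
  -- time 0 and rests at B; τ < 0 gives no displacement.
  displacement : (A B : Point) → 0# < dist A B → ℝ → Point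
  displacement A B 0<AB τ =
    ((0# ⊔ (τ ⊓ dist A B)) / dist A B [ 0<AB ]) ·ₚ (B -ₚ A)


module Delivery {c ℓ₁ ℓ₂} (R : RealField c ℓ₁ ℓ₂) where
  open RealField R
  open OrderLemmas R
  open Plane R

  private
    commutativeRing : CommutativeRing c ℓ₁
    commutativeRing = record { isCommutativeRing = isCommutativeRing }

    open NatSolver (CommutativeRing.commutativeSemiring commutativeRing)
      using (solve; _:=_; _:+_; _:*_; con)
    open HeytingProperties heytingCommutativeRing using (x-0≈x)
    open RingProperties (CommutativeRing.ring commutativeRing)
      using (+-cancelʳ)

  S T : Point
  S = 0# , 0#
  T = 1# , 0#

  -- Position at time s of the package if it is never handed over; t is the fail time.
  package : (t s : ℝ) → Point
  package t s = s ⊓ t , 0#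

  -- Position at time s ≥ p of a finisher that has picked up the package at
  -- time p and then moves at unit speed to T, resting there.
  carrying : (t p s : ℝ) → Point
  carrying t p s = (proj₁ (package t p) + (s - p)) ⊓ 1# , proj₂ (package t p)

  -- σ is the trajectory the finisher follows until it finds the package.
  IsPickupTime : (σ : ℝ → Point) (t p : ℝ) → Set (c Level.⊔ ℓ₁ Level.⊔ ℓ₂)
  IsPickupTime σ t = IsLeast (λ s → 0# ≤ s × σ s ≈ₚ package t s)

  IsDeliveryTime : (σ : ℝ → Point) (t a : ℝ) → Set (c Level.⊔ ℓ₁ Level.⊔ ℓ₂)
  IsDeliveryTime σ t a = ∃[ p ] (IsPickupTime σ t p ×
    IsLeast (λ s → p ≤ s × carrying t p s ≈ₚ T) a)

  Opt : Point → ℝ → ℝ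
  Opt P t = 1# ⊔ ((dist P (t , 0#) + 1#) - t)

  Opt-pos : ∀ P t → 0# < Opt P t
  Opt-pos P t = <-≤-trans 0<1 (proj₁ (⊔-supremum _ _))

  -- v is the competitive ratio of the algorithm which, for the starting
  -- position P, searches along σ and takes the package straight to T; this
  -- includes the claim that it delivers for every fail time.
  IsCompetitiveRatio : (P : Point) (σ : ℝ → Point) (v : ℝ) → Set (c Level.⊔ ℓ₁ Level.⊔ ℓ₂)
  IsCompetitiveRatio P σ v = Σ (ℝ → ℝ) λ A →
    (∀ t → 0# ≤ t → t ≤ 1# → IsDeliveryTime σ t (A t)) ×
    IsSupremum
      (λ r → ∃[ t ] (0# ≤ t × t ≤ 1# × r ≈ A t / Opt P t [ Opt-pos P t ])) v

  module _ (x y : ℝ) (0<x : 0# < x) where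

    0<xx+yy : 0# < x * x + y * y
    0<xx+yy = pos+nonneg (*-pos 0<x 0<x) (0≤x*x y)

    0<2x : 0# < (1# + 1#) * x
    0<2x = *-pos 0<2 0<x

    turn : ℝ
    turn = (x * x + y * y) / ((1# + 1#) * x) [ 0<2x ]

    turn-pos : 0# < turn
    turn-pos = /-pos 0<xx+yy 0<2x

    private
      d = turn
      e = x - d

    ee+yy≈dd : e * e + y * y ≈ d * d
    ee+yy≈dd = +-cancelʳ (e * d + e * d + d * d) _ _ (trans
      (solve 3 (λ e y d → (e :* e :+ y :* y) :+ (e :* d :+ e :* d :+ d :* d)
          := (e :+ d) :* (e :+ d) :+ y :* y) refl e y d)
      (trans (+-congʳ (*-cong e+d≈x e+d≈x)) (trans (sym (/-cancel _ 0<2x))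
      (trans (*-congʳ (*-congˡ (sym e+d≈x)))
      (solve 2 (λ e d → con 2 :* (e :+ d) :* d
          := d :* d :+ (e :* d :+ e :* d :+ d :* d)) refl e d)))))
      where
      e+d≈x : e + d ≈ x
      e+d≈x = trans (+-assoc x (- d) d) (trans (+-congˡ (-‿inverseˡ d)) (+-identityʳ x))

    0<P-turn : 0# < dist (x , y) (turn , 0#)
    0<P-turn = √-pos (<-respʳ-≈
      (trans (sym ee+yy≈dd) (+-congˡ (sym (*-cong (x-0≈x y) (x-0≈x y)))))
      (*-pos turn-pos turn-pos))

    0<turn-S : 0# < dist (turn , 0#) S
    0<turn-S = √-pos (pos+nonneg
      (<-respʳ-≈ (sym (*-cong (x-0≈x d) (x-0≈x d))) (*-pos turn-pos turn-pos))
      (0≤x*x _))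

    -- The search trajectory of 𝒜_d, with turn = d: two consecutive legs, the second one
    -- starting at time dist (x , y) (turn , 0#).
    search : ℝ → Point
    search s = ((x , y)
      +ₚ displacement (x , y) (turn , 0#) 0<P-turn s)
      +ₚ displacement (turn , 0#) S 0<turn-S (s - dist (x , y) (turn , 0#))

    denominator₁-pos : 0# < x * (1# + √ (x * x + y * y))
    denominator₁-pos = *-pos 0<x (pos+nonneg 0<1 (√-nonneg (<⇒≤ 0<xx+yy)))

    denominator₂-pos : 0# < x * ((√ x + 1#) * (√ x + 1#))
    denominator₂-pos = *-pos 0<x (*-pos 0<√x+1 0<√x+1)
      where
      0<√x+1 : 0# < √ x + 1#
      0<√x+1 = pos+nonneg (√-pos 0<x) (<⇒≤ 0<1)

  x-pos : ∀ {x y} → (x , y) #ₚ (0# , 0#) → (x , y) ∈D̄[ 1# , 1# ] → 0# < x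
  x-pos {x} {y} P#O P∈D = 0<x+x⇒0<x (<-≤-trans (0<∣P∣² P#O) xx+yy≤2x)
    where
    0<∣P∣² : (x , y) #ₚ (0# , 0#) → 0# < x * x + y * y
    0<∣P∣² (inj₁ x#0) = pos+nonneg (#0⇒0<x*x x#0) (0≤x*x y)
    0<∣P∣² (inj₂ y#0) = <-respʳ-≈ (+-comm _ _) (pos+nonneg (#0⇒0<x*x y#0) (0≤x*x x))
    e = x - 1#
    w = y - 0#
    e+1≈x : e + 1# ≈ x
    e+1≈x = trans (+-assoc x (- 1#) 1#) (trans (+-congˡ (-‿inverseˡ 1#)) (+-identityʳ x))
    ee+ww≤1 : e * e + w * w ≤ 1#
    ee+ww≤1 = √≤1⇒≤1 (nonneg+nonneg (0≤x*x e) (0≤x*x w)) P∈D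
    xx+yy≤2x : x * x + y * y ≤ x + x
    xx+yy≤2x 2x<xx+yy = ee+ww≤1 (+-cancelʳ-< (e + e + 1#)
      (<-respˡ-≈ (trans (+-cong (sym e+1≈x) (sym e+1≈x))
          (solve 1 (λ e → (e :+ con 1) :+ (e :+ con 1) := con 1 :+ (e :+ e :+ con 1)) refl e))
        (<-respʳ-≈ (trans (+-cong (*-cong (sym e+1≈x) (sym e+1≈x))
            (*-cong (sym (x-0≈x y)) (sym (x-0≈x y))))
          (solve 2 (λ e w → (e :+ con 1) :* (e :+ con 1) :+ w :* w
              := (e :* e :+ w :* w) :+ (e :+ e :+ con 1)) refl e w))
          2x<xx+yy)))

{-# OPTIONS --safe #-}
module Submission where

-- For fail time t ≤ d let u = dist P (t , 0) - t ≥ 0.  The finisher meets the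
-- package at time d + (d - t), so it delivers at time 1 + 2 (d - t), whereas
-- Opt = 1 + u.  Eliminating t through u² + 2 u t = 2 x (d - t), the ratio becomes
--   1 + (2d - x) · u / ((u + x)(1 + u)),   with x (2d - x) = y².
-- For t ≥ d it is 1, the value at u = 0.  The last factor grows with u up to
-- u = √x and then decreases, while u runs through [0 , √(x² + y²)].  Inside the
-- half-size disk √(x² + y²) ≤ √x, so t = 0 is the worst case; outside it the
-- worst case is u = √x, where (u + x)(1 + u) / u = (√x + 1)².

open import Defs
open import Algebra.Bundles using (CommutativeRing; RawRing)
open import Algebra.Solver.Ring.AlmostCommutativeRing using (_-Raw-AlmostCommutative⟶_; fromCommutativeRing)
open import Data.Empty using (⊥-elim)
open import Data.Integer.Base as ℤ using (ℤ; +_; -[1+_]; _⊖_; _◃_)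
import Data.Integer.Properties as ℤ
open import Data.Maybe.Base using (Maybe; just; nothing)
open import Data.Nat.Base as ℕ using (zero; suc)
import Data.Nat.Properties as ℕ
open import Data.Product.Base using (_×_; _,_; proj₁; proj₂)
import Data.Sign.Base as Sign
open import Data.Sum.Base using (inj₁; inj₂)
open import Function.Bundles using (Equivalence)
open import Relation.Binary.PropositionalEquality.Core as ≡ using (_≡_)
open import Relation.Nullary.Decidable.Core using (yes; no)
open import Relation.Nullary.Negation.Core using (¬_)
import Algebra.Properties.AbelianGroup as AbelianGroupProperties
import Algebra.Properties.Ring as RingProperties
import Algebra.Properties.Semiring.Mult.TCOptimised as Multiplication
import Algebra.Solver.Ring as RingSolver
import Relation.Binary.Reasoning.Setoid as SetoidReasoning

-- Ring solver with integer coefficients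

module IntegerSolver {c ℓ} (CR : CommutativeRing c ℓ) where
  open CommutativeRing CR
  open RingProperties ring using (-‿distribˡ-*; -‿distribʳ-*; -‿involutive; -0#≈0#)
  open AbelianGroupProperties +-abelianGroup using (⁻¹-∙-comm)
  open Multiplication semiring using (×-homo-+; ×1-homo-*; 1+×) renaming (_×_ to _·_)
  open SetoidReasoning setoid

  -- With this form of natural multiple, `con (+ 1)` and `con (+ 2)` evaluate to `1#` and `1# + 1#`
  -- definitionally, so solved identities fit goals written with these.
  ⟦_⟧ : ℤ → Carrier
  ⟦ + n ⟧      = n · 1#
  ⟦ -[1+ n ] ⟧ = - (suc n · 1#)

  ⟦⟧-cong : ∀ {i j} → i ≡ j → ⟦ i ⟧ ≈ ⟦ j ⟧
  ⟦⟧-cong ≡.refl = refl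

  ⊖-homo : ∀ m n → ⟦ m ⊖ n ⟧ ≈ m · 1# - n · 1#
  ⊖-homo m       zero    = sym (trans (+-congˡ -0#≈0#) (+-identityʳ _))
  ⊖-homo zero    (suc n) = sym (+-identityˡ _)
  ⊖-homo (suc m) (suc n) = begin
    ⟦ suc m ⊖ suc n ⟧                    ≈⟨ ⟦⟧-cong (ℤ.[1+m]⊖[1+n]≡m⊖n m n) ⟩
    ⟦ m ⊖ n ⟧                            ≈⟨ ⊖-homo m n ⟩
    a - b                                ≈⟨ +-congˡ (+-identityˡ (- b)) ⟨
    -- Here `1# - 1#` is inserted, so that each of the two multiples can absorb one unit and become
    -- a successor.
    a + (0# - b)                         ≈⟨ +-congˡ (+-congʳ (-‿inverseʳ 1#)) ⟨
    a + (1# - 1# - b)                    ≈⟨ +-congˡ (+-assoc 1# (- 1#) (- b)) ⟩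
    a + (1# + (- 1# - b))                ≈⟨ +-assoc a 1# _ ⟨
    a + 1# + (- 1# - b)                  ≈⟨ +-cong (+-comm a 1#) (⁻¹-∙-comm 1# b) ⟩
    1# + a - (1# + b)                    ≈⟨ +-cong (1+× m 1#) (-‿cong (1+× n 1#)) ⟨
    suc m · 1# - suc n · 1#              ∎
    where
    a = m · 1#
    b = n · 1#

  +-homo : ∀ i j → ⟦ i ℤ.+ j ⟧ ≈ ⟦ i ⟧ + ⟦ j ⟧
  +-homo (+ m)    (+ n)    = ×-homo-+ 1# m n
  +-homo (+ m)    -[1+ n ] = ⊖-homo m (suc n)
  +-homo -[1+ m ] (+ n)    = trans (⊖-homo n (suc m)) (+-comm _ _)
  +-homo -[1+ m ] -[1+ n ] = begin
    - (suc (suc (m ℕ.+ n)) · 1#)         ≈⟨ ⟦⟧-cong (≡.cong -[1+_] (≡.sym (ℕ.+-suc m n))) ⟩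
    - ((suc m ℕ.+ suc n) · 1#)           ≈⟨ -‿cong (×-homo-+ 1# (suc m) (suc n)) ⟩
    - (suc m · 1# + suc n · 1#)          ≈⟨ ⁻¹-∙-comm _ _ ⟨
    - (suc m · 1#) - suc n · 1#          ∎

  +◃-homo : ∀ n → ⟦ Sign.+ ◃ n ⟧ ≈ n · 1#
  +◃-homo zero    = refl
  +◃-homo (suc n) = refl

  -◃-homo : ∀ n → ⟦ Sign.- ◃ n ⟧ ≈ - (n · 1#)
  -◃-homo zero    = sym -0#≈0#
  -◃-homo (suc n) = refl

  *-homo : ∀ i j → ⟦ i ℤ.* j ⟧ ≈ ⟦ i ⟧ * ⟦ j ⟧
  *-homo (+ m)    (+ n)    = trans (+◃-homo (m ℕ.* n)) (×1-homo-* m n)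
  *-homo (+ m)    -[1+ n ] = begin
    ⟦ Sign.- ◃ (m ℕ.* suc n) ⟧           ≈⟨ -◃-homo (m ℕ.* suc n) ⟩
    - ((m ℕ.* suc n) · 1#)               ≈⟨ -‿cong (×1-homo-* m (suc n)) ⟩
    - (m · 1# * suc n · 1#)              ≈⟨ -‿distribʳ-* _ _ ⟩
    m · 1# * - (suc n · 1#)              ∎
  *-homo -[1+ m ] (+ n)    = begin
    ⟦ Sign.- ◃ (suc m ℕ.* n) ⟧           ≈⟨ -◃-homo (suc m ℕ.* n) ⟩
    - ((suc m ℕ.* n) · 1#)               ≈⟨ -‿cong (×1-homo-* (suc m) n) ⟩
    - (suc m · 1# * n · 1#)              ≈⟨ -‿distribˡ-* _ _ ⟩
    - (suc m · 1#) * n · 1#              ∎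
  *-homo -[1+ m ] -[1+ n ] = begin
    (suc m ℕ.* suc n) · 1#               ≈⟨ ×1-homo-* (suc m) (suc n) ⟩
    suc m · 1# * suc n · 1#              ≈⟨ -‿involutive _ ⟨
    - - (suc m · 1# * suc n · 1#)        ≈⟨ -‿cong (-‿distribʳ-* _ _) ⟩
    - (suc m · 1# * - (suc n · 1#))      ≈⟨ -‿distribˡ-* _ _ ⟩
    - (suc m · 1#) * - (suc n · 1#)      ∎

  -‿homo : ∀ i → ⟦ ℤ.- i ⟧ ≈ - ⟦ i ⟧
  -‿homo (+ zero)    = sym -0#≈0#
  -‿homo (+ (suc n)) = refl
  -‿homo -[1+ n ]    = sym (-‿involutive _)

  ℤ-rawRing : RawRing _ _
  ℤ-rawRing = record
    { _≈_ = _≡_ ; _+_ = ℤ._+_ ; _*_ = ℤ._*_ ; -_ = ℤ.-_ ; 0# = + 0 ; 1# = + 1 }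

  homomorphism : ℤ-rawRing -Raw-AlmostCommutative⟶ fromCommutativeRing CR
  homomorphism = record
    { ⟦_⟧    = ⟦_⟧
    ; +-homo = +-homo
    ; *-homo = *-homo
    ; -‿homo = -‿homo
    ; 0-homo = refl
    ; 1-homo = refl
    }

  -- Normal forms are compared through their coefficients, and equality in ℤ is decidable although
  -- `≈` on the carrier need not be.
  _≟_ : ∀ i j → Maybe (⟦ i ⟧ ≈ ⟦ j ⟧)
  i ≟ j with i ℤ.≟ j
  ... | yes i≡j = just (⟦⟧-cong i≡j)
  ... | no  _   = nothing

  open RingSolver ℤ-rawRing (fromCommutativeRing CR) homomorphism _≟_ public
    using (solve; _:=_; _:+_; _:*_; _:-_; con)

-- Order, square roots, maxima and minima over the constructive reals

module RealLemmas {c ℓ₁ ℓ₂} (R : RealField c ℓ₁ ℓ₂) where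
  open RealField R
  open OrderLemmas R

  commutativeRing : CommutativeRing c ℓ₁
  commutativeRing = record { isCommutativeRing = isCommutativeRing }

  open IntegerSolver commutativeRing public using (solve; _:=_; _:+_; _:*_; _:-_; con)

  ≈⇒≤ : ∀ {a b} → a ≈ b → a ≤ b
  ≈⇒≤ a≈b b<a = <-irrefl (sym a≈b) b<a

  ≤-antisym : ∀ {a b} → a ≤ b → b ≤ a → a ≈ b
  ≤-antisym {a} {b} a≤b b≤a = proj₁ (tight a b) a≮b≮a
    where
    a≮b≮a : ¬ (a # b)
    a≮b≮a a#b with Equivalence.to #⇔<⊎> a#b
    ... | inj₁ a<b = b≤a a<b
    ... | inj₂ b<a = a≤b b<a

  ≤-trans : ∀ {a b c} → a ≤ b → b ≤ c → a ≤ c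
  ≤-trans {b = b} a≤b b≤c c<a with <-cotrans c<a b
  ... | inj₁ c<b = b≤c c<b
  ... | inj₂ b<a = a≤b b<a

  ≤-respˡ : ∀ {a b c} → a ≈ b → a ≤ c → b ≤ c
  ≤-respˡ a≈b = ≤-trans (≈⇒≤ (sym a≈b))

  ≤-respʳ : ∀ {a b c} → b ≈ c → a ≤ b → a ≤ c
  ≤-respʳ b≈c a≤b = ≤-trans a≤b (≈⇒≤ b≈c)

  -- Negations are stable, so ≤ and ≈ may be proved by comparing two reals
  -- although the order is not decidable.
  ¬-cases : ∀ a b {p} {X : Set p} → (a ≤ b → ¬ X) → (b ≤ a → ¬ X) → ¬ X
  ¬-cases a b f g X = g (λ a<b → f (<⇒≤ a<b) X) X

  ≈-cases : ∀ a b {u v} → (a ≤ b → u ≈ v) → (b ≤ a → u ≈ v) → u ≈ v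
  ≈-cases a b f g = ≤-antisym
    (¬-cases a b (λ h → ≈⇒≤ (f h)) (λ h → ≈⇒≤ (g h)))
    (¬-cases a b (λ h → ≈⇒≤ (sym (f h))) (λ h → ≈⇒≤ (sym (g h))))

  0≤b-a⇒a≤b : ∀ {a b} → 0# ≤ b - a → a ≤ b
  0≤b-a⇒a≤b {a} 0≤b-a b<a = 0≤b-a (<-respʳ-≈ (-‿inverseʳ a) (+-monoˡ-< (- a) b<a))

  a≤b⇒0≤b-a : ∀ {a b} → a ≤ b → 0# ≤ b - a
  a≤b⇒0≤b-a {a} a≤b b-a<0 = a≤b (+-cancelʳ-< (- a) (<-respʳ-≈ (sym (-‿inverseʳ a)) b-a<0))

  a<b⇒0<b-a : ∀ {a b} → a < b → 0# < b - a
  a<b⇒0<b-a {a} a<b = <-respˡ-≈ (-‿inverseʳ a) (+-monoˡ-< (- a) a<b)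

  -- Certificates: the hypotheses are collected in a combination z that
  -- vanishes, and the remaining ring identity is left to the solver.
  infixl 7 _⊛_
  infixl 6 _⊞_

  _⊛_ : ∀ k {l r} → l ≈ r → k * (l - r) ≈ 0#
  k ⊛ l≈r = trans (*-congˡ (trans (+-congʳ l≈r) (-‿inverseʳ _))) (zeroʳ k)

  _⊞_ : ∀ {a b} → a ≈ 0# → b ≈ 0# → a + b ≈ 0#
  a≈0 ⊞ b≈0 = trans (+-cong a≈0 b≈0) (+-identityʳ 0#)

  ≈-by : ∀ {a b z} → z ≈ 0# → a - b ≈ z → a ≈ b
  ≈-by {a} {b} z≈0 a-b≈z = begin
    a           ≈⟨ solve 2 (λ a b → a := b :+ (a :- b)) refl a b ⟩
    b + (a - b) ≈⟨ +-congˡ (trans a-b≈z z≈0) ⟩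
    b + 0#      ≈⟨ +-identityʳ b ⟩
    b           ∎
    where open SetoidReasoning (CommutativeRing.setoid commutativeRing)

  ≤-by : ∀ {a b e z} → 0# ≤ e → z ≈ 0# → b - a ≈ e + z → a ≤ b
  ≤-by 0≤e z≈0 eq = 0≤b-a⇒a≤b
    (≤-respʳ (sym (trans eq (trans (+-congˡ z≈0) (+-identityʳ _)))) 0≤e)

  ≤-by-nonneg : ∀ {a b e} → 0# ≤ e → b - a ≈ e → a ≤ b
  ≤-by-nonneg 0≤e eq = 0≤b-a⇒a≤b (≤-respʳ (sym eq) 0≤e)

  -- A factor that is also `≤ 0#` would be zero, so each factor is not not positive; this suffices
  -- because the goal is a refutation.
  *-nonneg : ∀ {a b} → 0# ≤ a → 0# ≤ b → 0# ≤ a * b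
  *-nonneg {a} {b} 0≤a 0≤b ab<0 = a≰0 λ 0<a → b≰0 λ 0<b → <⇒≤ (*-pos 0<a 0<b) ab<0
    where
    a≰0 : ¬ (a ≤ 0#)
    a≰0 a≤0 = <-irrefl (trans (*-congʳ (≤-antisym a≤0 0≤a)) (zeroˡ b)) ab<0
    b≰0 : ¬ (b ≤ 0#)
    b≰0 b≤0 = <-irrefl (trans (*-congˡ (≤-antisym b≤0 0≤b)) (zeroʳ a)) ab<0

  *-cancelˡ-nonneg : ∀ {k a} → 0# < k → 0# ≤ k * a → 0# ≤ a
  *-cancelˡ-nonneg {k} {a} 0<k 0≤ka a<0 = <-irrefl
    (solve 2 (λ k a → con (+ 0) := k :* (con (+ 0) :- a) :+ k :* a) refl k a)
    (pos+nonneg (*-pos 0<k (<-respʳ-≈ (sym (+-identityˡ (- a))) (0<-x a<0))) 0≤ka)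

  *-cancelˡ-≤ : ∀ {k a b} → 0# < k → k * a ≤ k * b → a ≤ b
  *-cancelˡ-≤ {k} {a} {b} 0<k ka≤kb = 0≤b-a⇒a≤b (*-cancelˡ-nonneg 0<k
    (≤-respʳ (solve 3 (λ k a b → k :* b :- k :* a := k :* (b :- a)) refl k a b)
      (a≤b⇒0≤b-a ka≤kb)))

  *-cancelˡ-≈ : ∀ {k a b} → 0# < k → k * a ≈ k * b → a ≈ b
  *-cancelˡ-≈ 0<k ka≈kb =
    ≤-antisym (*-cancelˡ-≤ 0<k (≈⇒≤ ka≈kb)) (*-cancelˡ-≤ 0<k (≈⇒≤ (sym ka≈kb)))

  -- If `b < a`, then (a - b)(a + b) is positive and b² - a² nonnegative, yet they sum to 0.
  square-cancel-≤ : ∀ {a b} → 0# ≤ b → a * a ≤ b * b → a ≤ b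
  square-cancel-≤ {a} {b} 0≤b aa≤bb b<a = <-irrefl
    (solve 2 (λ a b → con (+ 0) := (a :- b) :* (a :+ b) :+ (b :* b :- a :* a)) refl a b)
    (pos+nonneg (*-pos (a<b⇒0<b-a b<a) 0<a+b) (a≤b⇒0≤b-a aa≤bb))
    where
    0<a : 0# < a
    0<a with <-cotrans b<a 0#
    ... | inj₁ b<0 = ⊥-elim (0≤b b<0)
    ... | inj₂ 0<a = 0<a
    0<a+b : 0# < a + b
    0<a+b = pos+nonneg 0<a 0≤b

  -- Serves to evaluate distances: it is enough to exhibit a nonnegative number with the right
  -- square.
  √-unique : ∀ {a b} → 0# ≤ b → b * b ≈ a → √ a ≈ b
  √-unique {a} {b} 0≤b bb≈a = ≤-antisym
    (square-cancel-≤ 0≤b (≈⇒≤ (trans (√-square 0≤a) (sym bb≈a))))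
    (square-cancel-≤ (√-nonneg 0≤a) (≈⇒≤ (trans bb≈a (sym (√-square 0≤a)))))
    where
    0≤a : 0# ≤ a
    0≤a = ≤-respʳ bb≈a (0≤x*x b)

  ≤-square⇒√≤ : ∀ {a b} → 0# ≤ a → 0# ≤ b → a ≤ b * b → √ a ≤ b
  ≤-square⇒√≤ 0≤a 0≤b a≤bb = square-cancel-≤ 0≤b (≤-respˡ (sym (√-square 0≤a)) a≤bb)

  √≤⇒≤-square : ∀ {a b} → 0# ≤ a → √ a ≤ b → a ≤ b * b
  √≤⇒≤-square {a} {b} 0≤a √a≤b = ≤-by
    (*-nonneg (a≤b⇒0≤b-a √a≤b) (nonneg+nonneg (≤-trans (√-nonneg 0≤a) √a≤b) (√-nonneg 0≤a)))
    (1# ⊛ √-square 0≤a)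
    (solve 3 (λ a b s → b :* b :- a := (b :- s) :* (b :+ s) :+ con (+ 1) :* (s :* s :- a))
      refl a b (√ a))

  x≤y⇒x⊔y≈y : ∀ {x y} → x ≤ y → x ⊔ y ≈ y
  x≤y⇒x⊔y≈y {x} {y} x≤y with ⊔-supremum x y
  ... | _ , y≤x⊔y , least = ≤-antisym (least y x≤y (≈⇒≤ refl)) y≤x⊔y

  y≤x⇒x⊔y≈x : ∀ {x y} → y ≤ x → x ⊔ y ≈ x
  y≤x⇒x⊔y≈x {x} {y} y≤x with ⊔-supremum x y
  ... | x≤x⊔y , _ , least = ≤-antisym (least x (≈⇒≤ refl) y≤x) x≤x⊔y

  x≤y⇒x⊓y≈x : ∀ {x y} → x ≤ y → x ⊓ y ≈ x
  x≤y⇒x⊓y≈x {x} {y} x≤y with ⊓-infimum x y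
  ... | x⊓y≤x , _ , greatest = ≤-antisym x⊓y≤x (greatest x (≈⇒≤ refl) x≤y)

  y≤x⇒x⊓y≈y : ∀ {x y} → y ≤ x → x ⊓ y ≈ y
  y≤x⇒x⊓y≈y {x} {y} y≤x with ⊓-infimum x y
  ... | _ , x⊓y≤y , greatest = ≤-antisym x⊓y≤y (greatest y y≤x (≈⇒≤ refl))

  x⊓y≤x : ∀ x y → x ⊓ y ≤ x
  x⊓y≤x x y = proj₁ (⊓-infimum x y)

  x⊓y≤y : ∀ x y → x ⊓ y ≤ y
  x⊓y≤y x y = proj₁ (proj₂ (⊓-infimum x y))

  x≤x⊔y : ∀ x y → x ≤ x ⊔ y
  x≤x⊔y x y = proj₁ (⊔-supremum x y)

  ⊔-least : ∀ {x y z} → x ≤ z → y ≤ z → x ⊔ y ≤ z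
  ⊔-least {x} {y} {z} = proj₂ (proj₂ (⊔-supremum x y)) z

  /-unique : ∀ {a b q} (0<b : 0# < b) → b * q ≈ a → q ≈ a / b [ 0<b ]
  /-unique {a} 0<b bq≈a = *-cancelˡ-≈ 0<b (trans bq≈a (sym (/-cancel a 0<b)))

  /-≤ : ∀ {a b v} (0<b : 0# < b) → a ≤ b * v → a / b [ 0<b ] ≤ v
  /-≤ {a} 0<b a≤bv = *-cancelˡ-≤ 0<b (≤-respˡ (sym (/-cancel a 0<b)) a≤bv)

-- Search trajectory: to `(d , 0#)` first, then back towards `S`

module TurnBack {c ℓ₁ ℓ₂} (R : RealField c ℓ₁ ℓ₂)
  (x y : RealField.ℝ R) (0<x : RealField._<_ R (RealField.0# R) x) where
  open RealField R
  open OrderLemmas R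
  open Plane R
  open Delivery R
  open RealLemmas R

  P : Point
  P = x , y

  σ : ℝ → Point
  σ = search x y 0<x

  d : ℝ
  d = turn x y 0<x

  0<d : 0# < d
  0<d = turn-pos x y 0<x

  0≤d : 0# ≤ d
  0≤d = <⇒≤ 0<d

  2xd≈xx+yy : (1# + 1#) * x * d ≈ x * x + y * y
  2xd≈xx+yy = /-cancel (x * x + y * y) (0<2x x y 0<x)

  D₁ D₂ : ℝ
  D₁ = dist P (d , 0#)
  D₂ = dist (d , 0#) S

  -- The equation 2xd = x² + y² puts `(d , 0#)` on the perpendicular bisector of `S` and `P`, so
  -- both legs have length d.
  D₁≈d : D₁ ≈ d
  D₁≈d = √-unique 0≤d (≈-by (1# ⊛ 2xd≈xx+yy)
    (solve 3 (λ x y d → d :* d :- ((x :- d) :* (x :- d) :+ (y :- con (+ 0)) :* (y :- con (+ 0)))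
      := con (+ 1) :* (con (+ 2) :* x :* d :- (x :* x :+ y :* y))) refl x y d))

  D₂≈d : D₂ ≈ d
  D₂≈d = √-unique 0≤d
    (solve 1 (λ d → d :* d := (d :- con (+ 0)) :* (d :- con (+ 0))
      :+ (con (+ 0) :- con (+ 0)) :* (con (+ 0) :- con (+ 0))) refl d)

  leg₁ leg₂ : ℝ → ℝ
  leg₁ s = 0# ⊔ (s ⊓ D₁)
  leg₂ s = 0# ⊔ ((s - D₁) ⊓ D₂)

  ratio₁ ratio₂ : ℝ → ℝ
  ratio₁ s = leg₁ s / D₁ [ 0<P-turn x y 0<x ]
  ratio₂ s = leg₂ s / D₂ [ 0<turn-S x y 0<x ]

  d*ratio₁ : ∀ s → d * ratio₁ s ≈ leg₁ s
  d*ratio₁ s = trans (*-congʳ (sym D₁≈d)) (/-cancel (leg₁ s) (0<P-turn x y 0<x))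

  d*ratio₂ : ∀ s → d * ratio₂ s ≈ leg₂ s
  d*ratio₂ s = trans (*-congʳ (sym D₂≈d)) (/-cancel (leg₂ s) (0<turn-S x y 0<x))

  leg₁-before : ∀ {s} → 0# ≤ s → s ≤ d → leg₁ s ≈ s
  leg₁-before 0≤s s≤d = trans (x≤y⇒x⊔y≈y (≤-respʳ (sym ⊓≈s) 0≤s)) ⊓≈s
    where ⊓≈s = x≤y⇒x⊓y≈x (≤-respʳ (sym D₁≈d) s≤d)

  leg₁-after : ∀ {s} → d ≤ s → leg₁ s ≈ d
  leg₁-after d≤s = trans (x≤y⇒x⊔y≈y (≤-respʳ (sym ⊓≈d) 0≤d)) ⊓≈d
    where ⊓≈d = trans (y≤x⇒x⊓y≈y (≤-respˡ (sym D₁≈d) d≤s)) D₁≈d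

  ratio₁-after : ∀ {s} → d ≤ s → ratio₁ s ≈ 1#
  ratio₁-after d≤s = *-cancelˡ-≈ 0<d
    (trans (d*ratio₁ _) (trans (leg₁-after d≤s) (sym (*-identityʳ d))))

  s-D₁≈s-d : ∀ s → s - D₁ ≈ s - d
  s-D₁≈s-d s = +-congˡ (-‿cong D₁≈d)

  leg₂-before : ∀ {s} → s ≤ d → leg₂ s ≈ 0#
  leg₂-before {s} s≤d = y≤x⇒x⊔y≈x (≤-trans (x⊓y≤x _ _) (≤-respˡ (sym (s-D₁≈s-d s))
    (≤-by-nonneg (a≤b⇒0≤b-a s≤d)
      (solve 2 (λ s d → con (+ 0) :- (s :- d) := d :- s) refl s d))))

  -- Only an upper bound, since the finisher rests once it reaches `S`; the minimality of the pickup
  -- time uses it in this form.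
  leg₂-after : ∀ {s} → d ≤ s → leg₂ s ≤ s - d
  leg₂-after {s} d≤s =
    ⊔-least (a≤b⇒0≤b-a d≤s) (≤-respʳ (s-D₁≈s-d s) (x⊓y≤x _ _))

  leg₂-between : ∀ {s} → d ≤ s → s - d ≤ d → leg₂ s ≈ s - d
  leg₂-between {s} d≤s s-d≤d =
    trans (x≤y⇒x⊔y≈y (≤-respʳ (sym ⊓≈s-d) (a≤b⇒0≤b-a d≤s))) ⊓≈s-d
    where
    ⊓≈s-d : (s - D₁) ⊓ D₂ ≈ s - d
    ⊓≈s-d = trans
      (x≤y⇒x⊓y≈x (≤-respˡ (sym (s-D₁≈s-d s)) (≤-respʳ (sym D₂≈d) s-d≤d))) (s-D₁≈s-d s)

  -- Scaling by d clears the division by the length of the leg.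
  d*σ₁-before : ∀ {s} → 0# ≤ s → s ≤ d → d * proj₁ (σ s) ≈ d * x + s * (d - x)
  d*σ₁-before {s} 0≤s s≤d = ≈-by
    ((d - x) ⊛ trans (d*ratio₁ s) (leg₁-before 0≤s s≤d)
      ⊞ (0# - d) ⊛ trans (d*ratio₂ s) (leg₂-before s≤d))
    (solve 5 (λ x d s k l → d :* ((x :+ k :* (d :- x)) :+ l :* (con (+ 0) :- d))
        :- (d :* x :+ s :* (d :- x))
      := (d :- x) :* (d :* k :- s) :+ (con (+ 0) :- d) :* (d :* l :- con (+ 0)))
      refl x d s (ratio₁ s) (ratio₂ s))

  σ₁-after : ∀ {s} → d ≤ s → proj₁ (σ s) ≈ d - leg₂ s
  σ₁-after {s} d≤s = ≈-by
    ((d - x) ⊛ ratio₁-after d≤s ⊞ (0# - 1#) ⊛ d*ratio₂ s)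
    (solve 5 (λ x d k l c → ((x :+ k :* (d :- x)) :+ l :* (con (+ 0) :- d)) :- (d :- c)
      := (d :- x) :* (k :- con (+ 1)) :+ (con (+ 0) :- con (+ 1)) :* (d :* l :- c))
      refl x d (ratio₁ s) (ratio₂ s) (leg₂ s))

  σ₂-after : ∀ {s} → d ≤ s → proj₂ (σ s) ≈ 0#
  σ₂-after {s} d≤s = ≈-by
    ((0# - y) ⊛ ratio₁-after d≤s)
    (solve 3 (λ y k l → ((y :+ k :* (con (+ 0) :- y)) :+ l :* (con (+ 0) :- con (+ 0))) :- con (+ 0)
      := (con (+ 0) :- y) :* (k :- con (+ 1)))
      refl y (ratio₁ s) (ratio₂ s))

  -- Pickup and delivery times

  back : ℝ → ℝ
  back t = 0# ⊔ (d - t)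

  0≤back : ∀ t → 0# ≤ back t
  0≤back t = x≤x⊔y 0# (d - t)

  back-before : ∀ {t} → t ≤ d → back t ≈ d - t
  back-before t≤d = x≤y⇒x⊔y≈y (a≤b⇒0≤b-a t≤d)

  back-after : ∀ {t} → d ≤ t → back t ≈ 0#
  back-after {t} d≤t = y≤x⇒x⊔y≈x (≤-by-nonneg (a≤b⇒0≤b-a d≤t)
    (solve 2 (λ d t → con (+ 0) :- (d :- t) := t :- d) refl d t))

  back≤d : ∀ {t} → 0# ≤ t → back t ≤ d
  back≤d {t} 0≤t = ⊔-least 0≤d
    (≤-by-nonneg 0≤t (solve 2 (λ d t → d :- (d :- t) := t) refl d t))

  -- If `t ≤ d`, the finisher walks back from d to the package resting at t. If `d ≤ t`, the starter
  -- is at `(d , 0#)` exactly when the finisher arrives there, and the clamp in `back` makes the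
  -- pickup time d.
  pickup : ℝ → ℝ
  pickup t = d + back t

  d≤pickup : ∀ t → d ≤ pickup t
  d≤pickup t = ≤-by-nonneg (0≤back t) (solve 2 (λ d g → d :+ g :- d := g) refl d (back t))

  package-at-pickup : ∀ t → pickup t ⊓ t ≈ d - back t
  package-at-pickup t = ≈-cases t d
    (λ t≤d → trans (y≤x⇒x⊓y≈y (≤-trans t≤d (d≤pickup t))) (≈-by (1# ⊛ back-before t≤d)
      (solve 3 (λ t d g → t :- (d :- g) := con (+ 1) :* (g :- (d :- t))) refl t d (back t))))
    (λ d≤t →
      let p≈d = trans (+-congˡ (back-after d≤t)) (+-identityʳ d) in
      trans (x≤y⇒x⊓y≈x (≤-respˡ (sym p≈d) d≤t)) (≈-by ((1# + 1#) ⊛ back-after d≤t)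
        (solve 2 (λ d g → (d :+ g) :- (d :- g) := con (+ 2) :* (g :- con (+ 0)))
          refl d (back t))))

  -- While s < d, the finisher's abscissa times d is ds + x(d - s), strictly more than ds, whereas
  -- the package is never beyond s. So the finisher is still strictly ahead of the package.
  d≤meeting : ∀ {s} t → 0# ≤ s → σ s ≈ₚ package t s → d ≤ s
  d≤meeting {s} t 0≤s (σ₁≈ , _) s<d = <-irrefl refl (<-≤-trans (*-pos 0<x (a<b⇒0<b-a s<d))
    (≤-by (*-nonneg 0≤d (a≤b⇒0≤b-a (x⊓y≤x s t)))
      (1# ⊛ d*σ₁-before 0≤s (<⇒≤ s<d) ⊞ d ⊛ sym σ₁≈)
      (solve 5 (λ x d s m q → con (+ 0) :- x :* (d :- s)
        := d :* (s :- m) :+ (con (+ 1) :* (d :* q :- (d :* x :+ s :* (d :- x))) :+ d :* (m :- q)))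
        refl x d s (s ⊓ t) (proj₁ (σ s)))))

  pickup-isPickupTime : ∀ {t} → 0# ≤ t → IsPickupTime σ t (pickup t)
  pickup-isPickupTime {t} 0≤t =
    (≤-trans 0≤d d≤p , (trans (σ₁-after d≤p) (trans (+-congˡ (-‿cong leg₂≈back))
      (sym (package-at-pickup t))) , σ₂-after d≤p)) , least
    where
    d≤p = d≤pickup t
    p-d≈back : pickup t - d ≈ back t
    p-d≈back = solve 2 (λ d g → d :+ g :- d := g) refl d (back t)
    leg₂≈back : leg₂ (pickup t) ≈ back t
    leg₂≈back = trans (leg₂-between d≤p (≤-respˡ (sym p-d≈back) (back≤d 0≤t))) p-d≈back
    least : ∀ s → 0# ≤ s × σ s ≈ₚ package t s → pickup t ≤ s
    least s (0≤s , meet) = ≤-by-nonneg (a≤b⇒0≤b-a (≤-trans back≤leg₂ (leg₂-after d≤s)))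
      (solve 3 (λ s d g → s :- (d :+ g) := (s :- d) :- g) refl s d (back t))
      where
      d≤s = d≤meeting t 0≤s meet
      -- The common abscissa d - `leg₂ s` equals `s ⊓ t`, hence is at most t, so the finisher has
      -- already walked back at least d - t.
      back≤leg₂ : back t ≤ leg₂ s
      back≤leg₂ = ⊔-least (x≤x⊔y _ _) (≤-by (a≤b⇒0≤b-a (x⊓y≤y s t))
        (1# ⊛ trans (sym (proj₁ meet)) (σ₁-after d≤s))
        (solve 4 (λ c d t m → c :- (d :- t) := (t :- m) :+ con (+ 1) :* (m :- (d :- c)))
          refl (leg₂ s) d t (s ⊓ t)))

  -- The pickup happens at time d + `back t` and abscissa d - `back t`, from where 1 - d + `back t`
  -- remains to be travelled.
  delivery : ℝ → ℝ
  delivery t = 1# + (back t + back t)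

  delivery-isDeliveryTime : d ≤ 1# → ∀ {t} → 0# ≤ t → IsDeliveryTime σ t (delivery t)
  delivery-isDeliveryTime d≤1 {t} 0≤t = p , pickup-isPickupTime 0≤t , (p≤a , at-T , refl) , least
    where
    p = pickup t
    g = back t
    p≤a : p ≤ delivery t
    p≤a = ≤-by-nonneg (nonneg+nonneg (a≤b⇒0≤b-a d≤1) (0≤back t))
      (solve 2 (λ d g → con (+ 1) :+ (g :+ g) :- (d :+ g) := (con (+ 1) :- d) :+ g) refl d g)
    at-T : (p ⊓ t + (delivery t - p)) ⊓ 1# ≈ 1#
    at-T = y≤x⇒x⊓y≈y (≈⇒≤ (≈-by (1# ⊛ sym (package-at-pickup t))
      (solve 3 (λ d g m → con (+ 1) :- (m :+ (con (+ 1) :+ (g :+ g) :- (d :+ g)))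
        := con (+ 1) :* (d :- g :- m)) refl d g (p ⊓ t))))
    least : ∀ s → p ≤ s × carrying t p s ≈ₚ T → delivery t ≤ s
    -- The abscissa is capped at 1, so being at `T` yields only that the uncapped abscissa is at
    -- least 1; this inequality bounds s from below.
    least s (_ , ⊓≈1 , _) = ≤-by (a≤b⇒0≤b-a (≤-respˡ ⊓≈1 (x⊓y≤x _ _)))
      (1# ⊛ sym (package-at-pickup t))
      (solve 4 (λ d g m s → s :- (con (+ 1) :+ (g :+ g))
        := (m :+ (s :- (d :+ g)) :- con (+ 1)) :+ con (+ 1) :* (d :- g :- m)) refl d g (p ⊓ t) s)

  -- The excess of the optimum over 1 as a parameter replacing t

  excess : ℝ → ℝ
  excess t = dist P (t , 0#) - t

  dist²≈ : ∀ t → dist P (t , 0#) * dist P (t , 0#) ≈ (x - t) * (x - t) + (y - 0#) * (y - 0#)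
  dist²≈ t = √-square (nonneg+nonneg (0≤x*x (x - t)) (0≤x*x (y - 0#)))

  -- The squared distance from `P` to `(t , 0#)` exceeds t² by 2x(d - t).
  0≤excess : ∀ {t} → t ≤ d → 0# ≤ excess t
  0≤excess {t} t≤d = a≤b⇒0≤b-a (square-cancel-≤
    (√-nonneg (nonneg+nonneg (0≤x*x (x - t)) (0≤x*x (y - 0#))))
    (≤-by (*-nonneg (<⇒≤ (0<2x x y 0<x)) (a≤b⇒0≤b-a t≤d))
      (1# ⊛ dist²≈ t ⊞ (0# - 1#) ⊛ 2xd≈xx+yy)
      (solve 5 (λ x y d t r → r :* r :- t :* t
        := con (+ 2) :* x :* (d :- t)
          :+ (con (+ 1) :* (r :* r :- ((x :- t) :* (x :- t) :+ (y :- con (+ 0)) :* (y :- con (+ 0))))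
            :+ (con (+ 0) :- con (+ 1)) :* (con (+ 2) :* x :* d :- (x :* x :+ y :* y))))
        refl x y d t (dist P (t , 0#)))))

  -- The equation u² + 2 u t = 2 x (d - t) of the excess u, solved for t.
  excess-equation : ∀ t → (1# + 1#) * t * (excess t + x) ≈ (1# + 1#) * x * d - excess t * excess t
  excess-equation t = ≈-by (1# ⊛ dist²≈ t ⊞ (0# - 1#) ⊛ 2xd≈xx+yy)
    (solve 5 (λ x y d t r → con (+ 2) :* t :* ((r :- t) :+ x)
        :- (con (+ 2) :* x :* d :- (r :- t) :* (r :- t))
      := con (+ 1) :* (r :* r :- ((x :- t) :* (x :- t) :+ (y :- con (+ 0)) :* (y :- con (+ 0))))
          :+ (con (+ 0) :- con (+ 1)) :* (con (+ 2) :* x :* d :- (x :* x :+ y :* y)))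
      refl x y d t (dist P (t , 0#)))

  -- The equation says that (u + t)² is the squared distance from `P` to `(t , 0#)`. This converse
  -- of `excess-equation` evaluates the excess at the fail times d, 0 and `t₀`.
  excess-unique : ∀ {t u} → 0# ≤ u + t →
    (1# + 1#) * t * (u + x) ≈ (1# + 1#) * x * d - u * u → excess t ≈ u
  excess-unique {t} {u} 0≤u+t eq = ≈-by (1# ⊛ √-unique 0≤u+t (≈-by
      (1# ⊛ eq ⊞ 1# ⊛ 2xd≈xx+yy)
      (solve 5 (λ x y d t u → (u :+ t) :* (u :+ t)
          :- ((x :- t) :* (x :- t) :+ (y :- con (+ 0)) :* (y :- con (+ 0)))
        := con (+ 1) :* (con (+ 2) :* t :* (u :+ x) :- (con (+ 2) :* x :* d :- u :* u))
          :+ con (+ 1) :* (con (+ 2) :* x :* d :- (x :* x :+ y :* y))) refl x y d t u)))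
    (solve 3 (λ r t u → r :- t :- u := con (+ 1) :* (r :- (u :+ t))) refl (dist P (t , 0#)) t u)

  excess-at-turn : excess d ≈ 0#
  excess-at-turn = excess-unique (≤-respʳ (sym (+-identityˡ d)) 0≤d)
    (solve 2 (λ x d → con (+ 2) :* d :* (con (+ 0) :+ x)
      := con (+ 2) :* x :* d :- con (+ 0) :* con (+ 0)) refl x d)

  -- In terms of the excess u, the delivery time 1 + 2 (d - t) divided by
  -- Opt = 1 + u is 1 + u (2d - x) / ((u + x)(1 + u)).
  delivery-equation : ∀ {t u} → (1# + 1#) * t * (u + x) ≈ (1# + 1#) * x * d - u * u →
    (u + x) * (1# + (1# + 1#) * (d - t)) ≈ (u + x) * (1# + u) + u * ((1# + 1#) * d - x)
  delivery-equation {t} {u} eq = ≈-by ((0# - 1#) ⊛ eq)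
    (solve 4 (λ x d t u → (u :+ x) :* (con (+ 1) :+ con (+ 2) :* (d :- t))
        :- ((u :+ x) :* (con (+ 1) :+ u) :+ u :* (con (+ 2) :* d :- x))
      := (con (+ 0) :- con (+ 1)) :*
        (con (+ 2) :* t :* (u :+ x) :- (con (+ 2) :* x :* d :- u :* u))) refl x d t u)

  delivery-before : ∀ {t} → t ≤ d → delivery t ≈ 1# + (1# + 1#) * (d - t)
  delivery-before {t} t≤d = ≈-by ((1# + 1#) ⊛ back-before t≤d)
    (solve 3 (λ d t g → con (+ 1) :+ (g :+ g) :- (con (+ 1) :+ con (+ 2) :* (d :- t))
      := con (+ 2) :* (g :- (d :- t))) refl d t (back t))

  dist+1-t≈1+excess : ∀ t → dist P (t , 0#) + 1# - t ≈ 1# + excess t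
  dist+1-t≈1+excess t = solve 2 (λ r t → r :+ con (+ 1) :- t := con (+ 1) :+ (r :- t))
    refl (dist P (t , 0#)) t

  Opt-before : ∀ {t} → t ≤ d → Opt P t ≈ 1# + excess t
  Opt-before {t} t≤d = trans (x≤y⇒x⊔y≈y (≤-respʳ (sym (dist+1-t≈1+excess t))
    (≤-by-nonneg (0≤excess t≤d) (solve 1 (λ u → con (+ 1) :+ u :- con (+ 1) := u) refl (excess t)))))
    (dist+1-t≈1+excess t)

  -- For `d ≤ t` the delivery time is 1, so there only 1 ≤ v is at stake, and that is the given
  -- bound at t = d, where the excess vanishes. Attainment at `t₀` makes v the least upper bound.
  isCompetitiveRatio : d ≤ 1# → ∀ {v} →
    (∀ t → 0# ≤ t → t ≤ d → 1# + (1# + 1#) * (d - t) ≤ (1# + excess t) * v) →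
    ∀ t₀ → 0# ≤ t₀ → t₀ ≤ d → (1# + excess t₀) * v ≈ 1# + (1# + 1#) * (d - t₀) →
    IsCompetitiveRatio P σ v
  isCompetitiveRatio d≤1 {v} bound t₀ 0≤t₀ t₀≤d attained =
    delivery , (λ t 0≤t _ → delivery-isDeliveryTime d≤1 0≤t) ,
    (λ r (t , 0≤t , _ , r≈) → ≤-respˡ (sym r≈) (/-≤ (Opt-pos P t) (upper t 0≤t))) ,
    (λ u isBound → isBound v (t₀ , 0≤t₀ , ≤-trans t₀≤d d≤1 , /-unique (Opt-pos P t₀)
      (trans (*-congʳ (Opt-before t₀≤d)) (trans attained (sym (delivery-before t₀≤d))))))
    where
    1≤v : 1# ≤ v
    1≤v = ≤-by (a≤b⇒0≤b-a (bound d 0≤d (≈⇒≤ refl))) ((0# - v) ⊛ excess-at-turn)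
      (solve 3 (λ d u v → v :- con (+ 1)
        := ((con (+ 1) :+ u) :* v :- (con (+ 1) :+ con (+ 2) :* (d :- d)))
          :+ (con (+ 0) :- v) :* (u :- con (+ 0))) refl d (excess d) v)
    upper : ∀ t → 0# ≤ t → delivery t ≤ Opt P t * v
    upper t 0≤t = ¬-cases t d
      (λ t≤d → ≤-respˡ (sym (delivery-before t≤d)) (≤-respʳ (*-congʳ (sym (Opt-before t≤d)))
        (bound t 0≤t t≤d)))
      (λ d≤t → ≤-by
        (nonneg+nonneg (*-nonneg (a≤b⇒0≤b-a (x≤x⊔y _ _)) (≤-trans (<⇒≤ 0<1) 1≤v))
          (a≤b⇒0≤b-a 1≤v))
        ((0# - (1# + 1#)) ⊛ back-after d≤t)
        (solve 3 (λ o v g → o :* v :- (con (+ 1) :+ (g :+ g))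
          := ((o :- con (+ 1)) :* v :+ (v :- con (+ 1)))
            :+ (con (+ 0) :- con (+ 2)) :* (g :- con (+ 0))) refl (Opt P t) v (back t)))

  -- The constant 2d - x and the two disk conditions

  2d-x : ℝ
  2d-x = (1# + 1#) * d - x

  x[2d-x]≈yy : x * 2d-x ≈ y * y
  x[2d-x]≈yy = ≈-by (1# ⊛ 2xd≈xx+yy)
    (solve 3 (λ x y d → x :* (con (+ 2) :* d :- x) :- y :* y
      := con (+ 1) :* (con (+ 2) :* x :* d :- (x :* x :+ y :* y))) refl x y d)

  0≤2d-x : 0# ≤ 2d-x
  0≤2d-x = *-cancelˡ-nonneg 0<x (≤-respʳ (sym x[2d-x]≈yy) (0≤x*x y))

  -- Expanded, the disk condition reads x² + y² ≤ 2x, and the left side is 2xd.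
  unitDisk⇒d≤1 : P ∈D̄[ 1# , 1# ] → d ≤ 1#
  unitDisk⇒d≤1 P∈D = *-cancelˡ-≤ (0<2x x y 0<x) (≤-by
    (a≤b⇒0≤b-a (√≤⇒≤-square (nonneg+nonneg (0≤x*x _) (0≤x*x _)) P∈D))
    ((0# - 1#) ⊛ 2xd≈xx+yy)
    (solve 3 (λ x y d → con (+ 2) :* x :* con (+ 1) :- con (+ 2) :* x :* d
      := (con (+ 1) :* con (+ 1)
          :- ((x :- con (+ 1)) :* (x :- con (+ 1)) :+ (y :- con (+ 0)) :* (y :- con (+ 0))))
        :+ (con (+ 0) :- con (+ 1)) :* (con (+ 2) :* x :* d :- (x :* x :+ y :* y))) refl x y d))

  2*½≈1 : (1# + 1#) * ½ ≈ 1#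
  2*½≈1 = /-cancel 1# 0<2

  -- The terms ½² cancel and 2·½ = 1. The result compares the largest excess √(x² + y²) with the
  -- critical excess √x.
  halfDisk⇒ : P ∈D̄[ ½ , ½ ] → x * x + y * y ≤ x
  halfDisk⇒ P∈D = ≤-by
    (a≤b⇒0≤b-a (√≤⇒≤-square (nonneg+nonneg (0≤x*x _) (0≤x*x _)) P∈D))
    ((0# - x) ⊛ 2*½≈1)
    (solve 3 (λ x y h → x :- (x :* x :+ y :* y)
      := (h :* h :- ((x :- h) :* (x :- h) :+ (y :- con (+ 0)) :* (y :- con (+ 0))))
        :+ (con (+ 0) :- x) :* (con (+ 2) :* h :- con (+ 1))) refl x y ½)

  halfDisk⇐ : x * x + y * y ≤ x → P ∈D̄[ ½ , ½ ]
  halfDisk⇐ xx+yy≤x = ≤-square⇒√≤ (nonneg+nonneg (0≤x*x _) (0≤x*x _)) (<⇒≤ (/-pos 0<1 0<2))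
    (≤-by (a≤b⇒0≤b-a xx+yy≤x) (x ⊛ 2*½≈1)
      (solve 3 (λ x y h →
          h :* h :- ((x :- h) :* (x :- h) :+ (y :- con (+ 0)) :* (y :- con (+ 0)))
        := (x :- (x :* x :+ y :* y)) :+ x :* (con (+ 2) :* h :- con (+ 1))) refl x y ½))

  -- Inside the half-size disk: the worst fail time is 0

  module InsideHalfDisk (xx+yy≤x : x * x + y * y ≤ x) where

    ρ : ℝ
    ρ = √ (x * x + y * y)

    v : ℝ
    v = (x * x + y * y + x) / (x * (1# + ρ)) [ denominator₁-pos x y 0<x ]

    0≤xx+yy : 0# ≤ x * x + y * y
    0≤xx+yy = <⇒≤ (0<xx+yy x y 0<x)

    0≤ρ : 0# ≤ ρ
    0≤ρ = √-nonneg 0≤xx+yy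

    ρρ≈2xd : ρ * ρ ≈ (1# + 1#) * x * d
    ρρ≈2xd = trans (√-square 0≤xx+yy) (sym 2xd≈xx+yy)

    -- Identifies v as delivery time over optimum at fail time 0, where the excess is `ρ`; the
    -- `d - 0#` matches the general formula at t = 0.
    [1+ρ]v≈1+2d : (1# + ρ) * v ≈ 1# + (1# + 1#) * (d - 0#)
    [1+ρ]v≈1+2d = *-cancelˡ-≈ 0<x (≈-by
      (1# ⊛ /-cancel (x * x + y * y + x) (denominator₁-pos x y 0<x) ⊞ (0# - 1#) ⊛ 2xd≈xx+yy)
      (solve 5 (λ x y d r v → x :* ((con (+ 1) :+ r) :* v)
          :- x :* (con (+ 1) :+ con (+ 2) :* (d :- con (+ 0)))
        := con (+ 1) :* (x :* (con (+ 1) :+ r) :* v :- (x :* x :+ y :* y :+ x))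
          :+ (con (+ 0) :- con (+ 1)) :* (con (+ 2) :* x :* d :- (x :* x :+ y :* y)))
        refl x y d ρ v))

    ρ-equation : (1# + 1#) * 0# * (ρ + x) ≈ (1# + 1#) * x * d - ρ * ρ
    ρ-equation = ≈-by (1# ⊛ ρρ≈2xd)
      (solve 3 (λ x d r → con (+ 2) :* con (+ 0) :* (r :+ x) :- (con (+ 2) :* x :* d :- r :* r)
        := con (+ 1) :* (r :* r :- con (+ 2) :* x :* d)) refl x d ρ)

    excess-at-S : excess 0# ≈ ρ
    excess-at-S = excess-unique (≤-respʳ (sym (+-identityʳ ρ)) 0≤ρ) ρ-equation

    -- Cross-multiplied comparison of 1 + ku/((u + x)(1 + u)) at r and at u. The factor x - ru is
    -- split into two summands that are both nonnegative when 0 ≤ r, u ≤ r and r² ≤ x.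
    cross-difference : ∀ x r u k →
      (u + x) * (1# + u) * ((r + x) * (1# + r) + r * k)
        - (r + x) * (1# + r) * ((u + x) * (1# + u) + u * k)
      ≈ k * ((r - u) * ((x - r * r) + r * (r - u)))
    cross-difference = solve 4 (λ x r u k →
      (u :+ x) :* (con (+ 1) :+ u) :* ((r :+ x) :* (con (+ 1) :+ r) :+ r :* k)
        :- (r :+ x) :* (con (+ 1) :+ r) :* ((u :+ x) :* (con (+ 1) :+ u) :+ u :* k)
      := k :* ((r :- u) :* ((x :- r :* r) :+ r :* (r :- u)))) refl

    -- Replacing v by the ratio at fail time 0 leaves a comparison of two ratios. Multiplied by (u +
    -- x)(ρ + x), both sides can be rewritten by `delivery-equation`, and `cross-difference`
    -- applies.
    bound : ∀ t → 0# ≤ t → t ≤ d → 1# + (1# + 1#) * (d - t) ≤ (1# + excess t) * v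
    bound t 0≤t t≤d = *-cancelˡ-≤ (pos+nonneg 0<1 0≤ρ) (≤-respʳ right core)
      where
      u = excess t
      0≤u = 0≤excess t≤d
      0<u+x : 0# < u + x
      0<u+x = <-respʳ-≈ (+-comm x u) (pos+nonneg 0<x 0≤u)
      0<ρ+x : 0# < ρ + x
      0<ρ+x = <-respʳ-≈ (+-comm x ρ) (pos+nonneg 0<x 0≤ρ)
      shuffle : ∀ U W C a → U * W * (C * a) ≈ W * C * (U * a)
      shuffle = solve 4 (λ U W C a → U :* W :* (C :* a) := W :* C :* (U :* a)) refl
      lower : (u + x) * (ρ + x) * ((1# + ρ) * (1# + (1# + 1#) * (d - t)))
        ≈ (ρ + x) * (1# + ρ) * ((u + x) * (1# + u) + u * 2d-x)
      lower = trans (shuffle _ _ _ _) (*-congˡ (delivery-equation (excess-equation t)))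
      upper : (u + x) * (ρ + x) * ((1# + u) * (1# + (1# + 1#) * (d - 0#)))
        ≈ (u + x) * (1# + u) * ((ρ + x) * (1# + ρ) + ρ * 2d-x)
      upper = trans (*-congʳ (*-comm (u + x) (ρ + x)))
        (trans (shuffle _ _ _ _) (*-congˡ (delivery-equation ρ-equation)))
      -- By the excess equation and ρ² = 2xd, the difference ρ² - u² is 2t(u + x).
      u≤ρ : u ≤ ρ
      u≤ρ = square-cancel-≤ 0≤ρ (≤-by
        (*-nonneg (*-nonneg (<⇒≤ 0<2) 0≤t) (<⇒≤ 0<u+x))
        (1# ⊛ ρρ≈2xd ⊞ (0# - 1#) ⊛ excess-equation t)
        (solve 5 (λ x d t r u → r :* r :- u :* u
          := con (+ 2) :* t :* (u :+ x) :+ (con (+ 1) :* (r :* r :- con (+ 2) :* x :* d)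
            :+ (con (+ 0) :- con (+ 1))
              :* (con (+ 2) :* t :* (u :+ x) :- (con (+ 2) :* x :* d :- u :* u))))
          refl x d t ρ u))
      0≤x-uρ : 0# ≤ (x - ρ * ρ) + ρ * (ρ - u)
      0≤x-uρ = nonneg+nonneg (a≤b⇒0≤b-a (≤-respˡ (sym (√-square 0≤xx+yy)) xx+yy≤x))
        (*-nonneg 0≤ρ (a≤b⇒0≤b-a u≤ρ))
      core : (1# + ρ) * (1# + (1# + 1#) * (d - t)) ≤ (1# + u) * (1# + (1# + 1#) * (d - 0#))
      core = *-cancelˡ-≤ (*-pos 0<u+x 0<ρ+x) (≤-respˡ (sym lower) (≤-respʳ (sym upper) (≤-by-nonneg
        (*-nonneg 0≤2d-x (*-nonneg (a≤b⇒0≤b-a u≤ρ) 0≤x-uρ)) (cross-difference x ρ u 2d-x))))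
      right : (1# + u) * (1# + (1# + 1#) * (d - 0#)) ≈ (1# + ρ) * ((1# + u) * v)
      right = trans (*-congˡ (sym [1+ρ]v≈1+2d))
        (solve 3 (λ B C v → B :* (C :* v) := C :* (B :* v)) refl (1# + u) (1# + ρ) v)

    ratio : d ≤ 1# → IsCompetitiveRatio P σ v
    ratio d≤1 = isCompetitiveRatio d≤1 bound 0# (≈⇒≤ refl) 0≤d
      (trans (*-congʳ (+-congˡ excess-at-S)) [1+ρ]v≈1+2d)

  -- Outside the half-size disk: the worst excess is √x

  module OutsideHalfDisk (x≤xx+yy : x ≤ x * x + y * y) where

    q : ℝ
    q = √ x

    w : ℝ
    w = (y * y) / (x * ((q + 1#) * (q + 1#))) [ denominator₂-pos x y 0<x ]

    0<q : 0# < q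
    0<q = √-pos 0<x

    qq≈x : q * q ≈ x
    qq≈x = √-square (<⇒≤ 0<x)

    0<q+1 : 0# < q + 1#
    0<q+1 = pos+nonneg 0<q (<⇒≤ 0<1)

    0<q+x : 0# < q + x
    0<q+x = pos+nonneg 0<q (<⇒≤ 0<x)

    -- Since y² = x(2d - x), the factor x cancels; `w` is thus the amount by which the ratio exceeds
    -- 1 at excess √x.
    [q+1]²w≈2d-x : (q + 1#) * (q + 1#) * w ≈ 2d-x
    [q+1]²w≈2d-x = *-cancelˡ-≈ 0<x (trans (sym (*-assoc x _ w))
      (trans (/-cancel (y * y) (denominator₂-pos x y 0<x)) (sym x[2d-x]≈yy)))

    0≤w : 0# ≤ w
    0≤w = *-cancelˡ-nonneg (*-pos 0<q+1 0<q+1) (≤-respʳ (sym [q+1]²w≈2d-x) 0≤2d-x)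

    -- AM-GM: u (√x + 1)² ≤ (1 + u)(u + x), with defect (u - √x)².
    bound : ∀ t → 0# ≤ t → t ≤ d → 1# + (1# + 1#) * (d - t) ≤ (1# + excess t) * (1# + w)
    bound t _ t≤d = *-cancelˡ-≤ 0<u+x (≤-by
      (*-nonneg 0≤w (0≤x*x (u - q)))
      ((0# - 1#) ⊛ delivery-equation (excess-equation t)
        ⊞ u ⊛ [q+1]²w≈2d-x ⊞ (0# - w * (1# + u)) ⊛ qq≈x)
      (solve 6 (λ x d t q u w →
          let a = con (+ 1) :+ con (+ 2) :* (d :- t)
              k = con (+ 2) :* d :- x
          in (u :+ x) :* ((con (+ 1) :+ u) :* (con (+ 1) :+ w)) :- (u :+ x) :* a
            := w :* ((u :- q) :* (u :- q))
              :+ ((con (+ 0) :- con (+ 1))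
                  :* ((u :+ x) :* a :- ((u :+ x) :* (con (+ 1) :+ u) :+ u :* k))
                :+ u :* ((q :+ con (+ 1)) :* (q :+ con (+ 1)) :* w :- k)
                :+ (con (+ 0) :- w :* (con (+ 1) :+ u)) :* (q :* q :- x)))
        refl x d t q u w))
      where
      u = excess t
      0<u+x : 0# < u + x
      0<u+x = <-respʳ-≈ (+-comm x u) (pos+nonneg 0<x (0≤excess t≤d))

    0<2[q+x] : 0# < (1# + 1#) * (q + x)
    0<2[q+x] = *-pos 0<2 0<q+x

    -- The fail time with excess √x, the equality case of AM-GM.
    t₀ : ℝ
    t₀ = ((1# + 1#) * x * d - x) / ((1# + 1#) * (q + x)) [ 0<2[q+x] ]

    t₀-equation : (1# + 1#) * (q + x) * t₀ ≈ (1# + 1#) * x * d - x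
    t₀-equation = /-cancel _ 0<2[q+x]

    -- The position outside the half-size disk enters here: the numerator of `t₀` is x² + y² - x.
    0≤t₀ : 0# ≤ t₀
    0≤t₀ = *-cancelˡ-nonneg 0<2[q+x] (≤-respʳ (sym t₀-equation)
      (a≤b⇒0≤b-a (≤-respʳ (sym 2xd≈xx+yy) x≤xx+yy)))

    t₀≤d : t₀ ≤ d
    t₀≤d = *-cancelˡ-≤ 0<2[q+x] (≤-by
      (nonneg+nonneg (*-nonneg (*-nonneg (<⇒≤ 0<2) (<⇒≤ 0<q)) 0≤d) (<⇒≤ 0<x))
      ((0# - 1#) ⊛ t₀-equation)
      (solve 4 (λ x d q t → con (+ 2) :* (q :+ x) :* d :- con (+ 2) :* (q :+ x) :* t
        := (con (+ 2) :* q :* d :+ x) :+ (con (+ 0) :- con (+ 1))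
          :* (con (+ 2) :* (q :+ x) :* t :- (con (+ 2) :* x :* d :- x))) refl x d q t₀))

    q-equation : (1# + 1#) * t₀ * (q + x) ≈ (1# + 1#) * x * d - q * q
    q-equation = ≈-by (1# ⊛ t₀-equation ⊞ 1# ⊛ qq≈x)
      (solve 4 (λ x d q t → con (+ 2) :* t :* (q :+ x) :- (con (+ 2) :* x :* d :- q :* q)
        := con (+ 1) :* (con (+ 2) :* (q :+ x) :* t :- (con (+ 2) :* x :* d :- x))
          :+ con (+ 1) :* (q :* q :- x)) refl x d q t₀)

    -- The certificate of `bound` at u = √x, where its square term vanishes.
    attained : (1# + excess t₀) * (1# + w) ≈ 1# + (1# + 1#) * (d - t₀)
    attained = trans
      (*-congʳ (+-congˡ (excess-unique (nonneg+nonneg (<⇒≤ 0<q) 0≤t₀) q-equation)))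
      (*-cancelˡ-≈ 0<q+x (≈-by
        ((0# - 1#) ⊛ delivery-equation q-equation
          ⊞ q ⊛ [q+1]²w≈2d-x ⊞ (0# - (1# + q) * w) ⊛ qq≈x)
        (solve 5 (λ x d t q w →
          let a = con (+ 1) :+ con (+ 2) :* (d :- t)
              k = con (+ 2) :* d :- x
          in (q :+ x) :* ((con (+ 1) :+ q) :* (con (+ 1) :+ w)) :- (q :+ x) :* a
            := (con (+ 0) :- con (+ 1))
                :* ((q :+ x) :* a :- ((q :+ x) :* (con (+ 1) :+ q) :+ q :* k))
              :+ q :* ((q :+ con (+ 1)) :* (q :+ con (+ 1)) :* w :- k)
              :+ (con (+ 0) :- (con (+ 1) :+ q) :* w) :* (q :* q :- x))
          refl x d t₀ q w)))

    ratio : d ≤ 1# → IsCompetitiveRatio P σ (1# + w)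
    ratio d≤1 = isCompetitiveRatio d≤1 bound t₀ 0≤t₀ t₀≤d attained

  competitiveRatio : P ∈D̄[ 1# , 1# ] →
    (P ∈D̄[ ½ , ½ ] → IsCompetitiveRatio P σ
      ((x * x + y * y + x) / (x * (1# + √ (x * x + y * y))) [ denominator₁-pos x y 0<x ]))
    ×
    (¬ (P ∈D̄[ ½ , ½ ]) → IsCompetitiveRatio P σ
      (1# + (y * y) / (x * ((√ x + 1#) * (√ x + 1#))) [ denominator₂-pos x y 0<x ]))
  competitiveRatio P∈D =
    (λ P∈½D → InsideHalfDisk.ratio (halfDisk⇒ P∈½D) d≤1) ,
    -- The hypothesis x ≤ x² + y² is itself a negation, so it follows from `P∉½D` by contraposition,
    -- without deciding the order.
    (λ P∉½D → OutsideHalfDisk.ratio (λ xx+yy<x → P∉½D (halfDisk⇐ (<⇒≤ xx+yy<x))) d≤1)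
    where
    d≤1 : d ≤ 1#
    d≤1 = unitDisk⇒d≤1 P∈D

theorem3 : ∀ {c ℓ₁ ℓ₂} (R : RealField c ℓ₁ ℓ₂) →
    let open RealField R
        open OrderLemmas R
        open Plane R
        open Delivery R
    in
    (x y : ℝ) → (P#O : (x , y) #ₚ (0# , 0#)) → 0# ≤ y → (P∈D : (x , y) ∈D̄[ 1# , 1# ]) →
    let 0<x = x-pos P#O P∈D in
    ((x , y) ∈D̄[ ½ , ½ ] →
      IsCompetitiveRatio (x , y) (search x y 0<x)
        ((x * x + y * y + x) / (x * (1# + √ (x * x + y * y))) [ denominator₁-pos x y 0<x ]))
    ×
    (¬ ((x , y) ∈D̄[ ½ , ½ ]) →
      IsCompetitiveRatio (x , y) (search x y 0<x)
        (1# + (y * y) / (x * ((√ x + 1#) * (√ x + 1#))) [ denominator₂-pos x y 0<x ]))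
-- Unification supplies the proof of 0 < x; comparing a written-out copy of
-- x-pos with the one in the statement would unfold both.
theorem3 R x y P#O 0≤y P∈D = TurnBack.competitiveRatio R x y _ P∈D
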